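{- Let $n\ge 2$ be even and let $0\le p\le n/2$. The number $a_{n,p}$ of perfect matchings with $z$-weight $n_z=n/2-p$ and $w$-weight $n_w=0$ on the strip of hexagons with $n$ black nodes on the torus is $$a_{n,p}=\frac{n}{n-p}\binom{n-p}{p},$$ and for $p\ge 1$ this also equals $\dfrac{n}{p!}\prod_{q=1}^{p-1}(n-p-q)$.
   Context: Strip of squares. For even $n\ge2$, the strip of squares $\mathcal G_{2,n}$ on the torus is the multigraph with $2n$ nodes $(r,j)$, $r\in\mathbb Z/2$ (row; $r=0$ bottom, $r=1$ top), $j\in\mathbb Z/n$ (column). Node $(r,j)$ is black if $r+j$ is even and white otherwise, so there are $n$ black nodes. There are $4n$ distinct edges (parallel edges count as different): horizontal edges $h_{r,j}$ joining $(r,j)$ and $(r,j+1)$, and vertical edges $v_{r,j}$ joining $(r,j)$ and $(r+1,j)$, where $v_{r,j}$ is thought of as going upwards from $(r,j)$; thus $v_{0,j}$ is internal and $v_{1,j}$ crosses the cycle $z$ of the torus. Strip of hexagons. It is obtained from $\mathcal G_{2,n}$ by deleting half of the vertical edges, namely all $v_{r,j}$ with $(r,j)$ white; so each black node keeps its left, right and up edges. Weights. A perfect matching is a set of edges touching each node exactly once. Edges are directed from black to white. The $z$-weight $n_z$ of a matching $M$ is the sum over edges $v_{1,j}\in M$ of $+1$ if $(1,j)$ is black and $-1$ if $(1,j)$ is white. The $w$-weight $n_w$ of $M$ is the sum over edges $h_{r,n-1}\in M$ (those crossing the cycle $w$) of $+1$ if $(r,n-1)$ is black and $-1$ if $(r,n-1)$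 is white. -}

module Defs where

open import Data.Bool.Base using (if_then_else_)
open import Data.Fin.Base using (Fin; toℕ; fromℕ)
open import Data.Fin.Patterns using (1F)
import Data.Fin.Properties as Fin
import Data.Fin.Subset as Subset
open Subset using (Subset; Side; inside; outside)
import Data.Fin.Subset.Properties as Subset
open import Data.Integer.Base as ℤ using (ℤ; 0ℤ; 1ℤ; -1ℤ; +_)
import Data.Integer.Properties as ℤ
open import Data.List.Base using (List; []; _∷_; length; filter; map; upTo; cartesianProduct; cartesianProductWith)
open import Data.List.Membership.Propositional using () renaming (_∈_ to _∈ˡ_)
open import Data.List.Membership.Propositional.Properties using (∈-cartesianProduct⁺; ∈-cartesianProductWith⁺)
open import Data.List.Relation.Unary.All using ([]; _∷_)
open import Data.List.Relation.Unary.AllPairs using ([]; _∷_)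
open import Data.List.Relation.Unary.Any using (here; there)
open import Data.List.Relation.Unary.Unique.Propositional using (Unique)
import Data.List.Relation.Unary.Unique.Propositional.Properties as Unique
open import Data.Nat.Base using (ℕ; zero; suc; _+_; _∸_; _≤_; NonZero; >-nonZero)
open import Data.Nat.Divisibility using (_∣_; _∣?_)
open import Data.Nat.DivMod using (_/_; _mod_; m/n<m)
open import Data.Nat.ListAction using (product)
import Data.Nat.Properties as ℕ
open import Data.Product using (∃; ∃!; _×_; _,_; proj₁; proj₂)
open import Data.Product.Properties using (≡-dec)
open import Data.Rational.Base as ℚ using (ℚ)
open import Data.Sum.Base using (_⊎_; inj₁; inj₂; [_,_])
open import Data.Unit.Base using (⊤; tt)
open import Data.Vec.Base using (Vec; []; _∷_; lookup)
open import Data.Vec.Properties using (∷-injective)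
open import Relation.Binary.Definitions using (DecidableEquality)
open import Relation.Binary.PropositionalEquality using (_≡_; refl)
open import Relation.Nullary using (Dec; yes; no; does)
open import Relation.Nullary.Decidable using (map′; _×-dec_; _⊎-dec_; _→-dec_)
open import Relation.Unary using (Decidable)

open import Algebra.Properties.CommutativeMonoid.Sum ℤ.+-0-commutativeMonoid using (sum)

private
  variable
    n : ℕ

-- Fin n represents ℤ/n; this is the map j ↦ j + 1 of ℤ/n.
next : Fin n → Fin n
next {suc m} j = suc (toℕ j) mod suc m

-- (row , column)
Node : ℕ → Set
Node n = Fin 2 × Fin n

Black : Node n → Set
Black (r , j) = 2 ∣ toℕ r + toℕ j

black? : (x : Node n) → Dec (Black x)
black? (r , j) = 2 ∣? toℕ r + toℕ j

-- The 4n edges of the strip of squares.  Distinct edges may have the same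
-- ends (this happens in every column, and in the rows when n = 2).
data Edge (n : ℕ) : Set where
  h v : Fin 2 → Fin n → Edge n

ends : Edge n → Node n × Node n
ends (h r j) = (r , j) , (r , next j)
ends (v r j) = (r , j) , (next r , j)

Touches : Edge n → Node n → Set
Touches e x = proj₁ (ends e) ≡ x ⊎ proj₂ (ends e) ≡ x

-- The edges kept in the strip of hexagons.
InHexagons : Edge n → Set
InHexagons (h r j) = ⊤
InHexagons (v r j) = Black (r , j)

-- A set of edges is given by its horizontal and its vertical edges; each of
-- these is given, row by row, by a set of columns.  Two edge sets with the
-- same members are then propositionally equal.
EdgeSet : ℕ → Set
EdgeSet n = Vec (Subset n) 2 × Vec (Subset n) 2

infix 4 _∈_ _∈?_

_∈_ : Edge n → EdgeSet n → Set
h r j ∈ (H , V) = j Subset.∈ lookup H r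
v r j ∈ (H , V) = j Subset.∈ lookup V r

_∈?_ : (e : Edge n) (M : EdgeSet n) → Dec (e ∈ M)
h r j ∈? (H , V) = j Subset.∈? lookup H r
v r j ∈? (H , V) = j Subset.∈? lookup V r

PerfectMatching : EdgeSet n → Set
PerfectMatching {n} M =
  (∀ e → e ∈ M → InHexagons e) ×
  (∀ (x : Node n) → ∃! _≡_ λ e → e ∈ M × Touches e x)

-- Contribution of an edge crossing z upwards, or w rightwards, from x.  Edges
-- are directed from black to white, so it is +1 exactly when x is the source.
sign : Node n → ℤ
sign x = if does (black? x) then 1ℤ else -1ℤ

contribution : EdgeSet n → Edge n → ℤ
contribution M e = if does (e ∈? M) then sign (proj₁ (ends e)) else 0ℤ

zWeight : EdgeSet n → ℤ
zWeight M = sum λ j → contribution M (v 1F j)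

-- fromℕ m is the last column, n - 1.
wWeight : EdgeSet n → ℤ
wWeight {zero}  M = 0ℤ
wWeight {suc m} M = sum λ r → contribution M (h r (fromℕ m))

Counted : (n p : ℕ) → EdgeSet n → Set
Counted n p M = PerfectMatching M × zWeight M ≡ + (n / 2) ℤ.- + p × wWeight M ≡ 0ℤ

------------------------------------------------------------------------
-- Decidability

_≟ᴺ_ : DecidableEquality (Node n)
_≟ᴺ_ = ≡-dec Fin._≟_ Fin._≟_

_≟ᴱ_ : DecidableEquality (Edge n)
h r j ≟ᴱ h s k = map′ (λ { refl → refl }) (λ { refl → refl }) ((r , j) ≟ᴺ (s , k))
h r j ≟ᴱ v s k = no λ ()
v r j ≟ᴱ h s k = no λ ()
v r j ≟ᴱ v s k = map′ (λ { refl → refl }) (λ { refl → refl }) ((r , j) ≟ᴺ (s , k))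

touches? : (e : Edge n) (x : Node n) → Dec (Touches e x)
touches? e x = (proj₁ (ends e) ≟ᴺ x) ⊎-dec (proj₂ (ends e) ≟ᴺ x)

inHexagons? : (e : Edge n) → Dec (InHexagons e)
inHexagons? (h r j) = yes tt
inHexagons? (v r j) = black? (r , j)

allEdges? : {P : Edge n → Set} → Decidable P → Dec (∀ e → P e)
allEdges? P? = map′
  (λ { (f , g) (h r j) → f r j ; (f , g) (v r j) → g r j })
  (λ f → (λ r j → f (h r j)) , (λ r j → f (v r j)))
  (Fin.all? (λ r → Fin.all? λ j → P? (h r j)) ×-dec
   Fin.all? (λ r → Fin.all? λ j → P? (v r j)))

anyEdge? : {P : Edge n → Set} → Decidable P → Dec (∃ P)
anyEdge? P? = map′
  [ (λ { (r , j , q) → h r j , q }) , (λ { (r , j , q) → v r j , q }) ]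
  (λ { (h r j , q) → inj₁ (r , j , q) ; (v r j , q) → inj₂ (r , j , q) })
  (Fin.any? (λ r → Fin.any? λ j → P? (h r j)) ⊎-dec
   Fin.any? (λ r → Fin.any? λ j → P? (v r j)))

uniqueEdge? : {P : Edge n → Set} → Decidable P → Dec (∃! _≡_ P)
uniqueEdge? P? = anyEdge? λ e → P? e ×-dec
  map′ (λ f {y} → f y) (λ f y → f {y}) (allEdges? λ y → P? y →-dec (e ≟ᴱ y))

perfectMatching? : (M : EdgeSet n) → Dec (PerfectMatching M)
perfectMatching? M =
  allEdges? (λ e → (e ∈? M) →-dec inHexagons? e) ×-dec
  map′ (λ { f (r , j) → f r j }) (λ f r j → f (r , j))
    (Fin.all? λ r → Fin.all? λ j →
      uniqueEdge? λ e → (e ∈? M) ×-dec touches? e (r , j))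

counted? : (n p : ℕ) → Decidable (Counted n p)
counted? n p M =
  perfectMatching? M ×-dec (zWeight M ℤ.≟ + (n / 2) ℤ.- + p) ×-dec (wWeight M ℤ.≟ 0ℤ)

------------------------------------------------------------------------
-- Counting

vecs : {A : Set} → List A → (k : ℕ) → List (Vec A k)
vecs xs zero    = [] ∷ []
vecs xs (suc k) = cartesianProductWith _∷_ xs (vecs xs k)

sides : List Side
sides = outside ∷ inside ∷ []

edgeSets : (n : ℕ) → List (EdgeSet n)
edgeSets n = cartesianProduct (vecs (vecs sides n) 2) (vecs (vecs sides n) 2)

a : (n p : ℕ) → ℕ
a n p = length (filter (counted? n p) (edgeSets n))

-- edgeSets n lists every edge set exactly once, so a n p is the cardinality
-- of Counted n p.

∈-vecs : {A : Set} {xs : List A} → (∀ x → x ∈ˡ xs) → ∀ {k} (u : Vec A k) → u ∈ˡ vecs xs k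
∈-vecs all []      = here refl
∈-vecs all (x ∷ u) = ∈-cartesianProductWith⁺ _∷_ (all x) (∈-vecs all u)

vecs-unique : {A : Set} {xs : List A} → Unique xs → ∀ k → Unique (vecs xs k)
vecs-unique xs! zero    = [] ∷ []
vecs-unique xs! (suc k) = Unique.cartesianProductWith⁺ _∷_ ∷-injective xs! (vecs-unique xs! k)

∈-sides : ∀ s → s ∈ˡ sides
∈-sides outside = here refl
∈-sides inside  = there (here refl)

sides-unique : Unique sides
sides-unique = ((λ ()) ∷ []) ∷ [] ∷ []

∈-edgeSets : (M : EdgeSet n) → M ∈ˡ edgeSets n
∈-edgeSets (H , V) = ∈-cartesianProduct⁺ (∈-vecs (∈-vecs ∈-sides) H) (∈-vecs (∈-vecs ∈-sides) V)

edgeSets-unique : ∀ n → Unique (edgeSets n)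
edgeSets-unique n = Unique.cartesianProduct⁺ rows! rows!
  where rows! = vecs-unique (vecs-unique sides-unique n) 2

------------------------------------------------------------------------
-- The closed formulas

fromℕℚ : ℕ → ℚ
fromℕℚ k = + k ℚ./ 1

n∸p≢0 : ∀ {n p} → 2 ≤ n → p ≤ n / 2 → NonZero (n ∸ p)
n∸p≢0 {suc n} {p} 2≤n p≤n/2 =
  >-nonZero (ℕ.m<n⇒0<n∸m (ℕ.≤-<-trans p≤n/2 (m/n<m (suc n) 2 ℕ.≤-refl)))

-- ∏ (n - p - q) over 1 ≤ q ≤ p - 1, where q = suc i.  When p ≤ n / 2 every
-- factor is positive, so the truncated subtraction is the usual one.
fallingProduct : (n p : ℕ) → ℕ
fallingProduct n p = product (map (λ i → n ∸ p ∸ suc i) (upTo (p ∸ 1)))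

{-# OPTIONS --safe #-}

-- Every column of the strip of hexagons keeps exactly one rung, joining its
-- two nodes.  In a perfect matching the two horizontal edges of a gap between
-- columns are determined by those of the preceding gap, and once they are
-- both present or both absent at one gap this propagates around the torus;
-- n_w = 0 says that it holds at the gap crossing w.  The matching is therefore
-- given by the set S ⊆ ℤ/n of doubly occupied gaps, no two of which are
-- cyclically adjacent, and the columns away from S carry their rung.  Pairing
-- each odd column with the gaps on its two sides gives n_z = n/2 - |S|, so
-- |S| = p.  Splitting by whether 0 ∈ S gives C(n-p,p) + C(n-p-1,p-1) such
-- sets, and (n-p) C(n-p-1,p-1) = p C(n-p,p) turns this into the closed formula.
module Submission where

open import Defs
open import Data.Integer.Base using (+_)
open import Data.Nat.Base using (ℕ; _∸_; _≤_; _!)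
open import Data.Nat.Combinatorics using (_C_)
open import Data.Nat.Divisibility using (_∣_)
open import Data.Nat.DivMod using (_/_)
open import Data.Nat.Properties using (_!≢0)
open import Data.Product.Base using (_×_)
open import Data.Rational.Base as ℚ using (ℚ)
open import Relation.Binary.PropositionalEquality using (_≡_)

open import Data.Bool.Base using (if_then_else_; _∨_; not; true; false)
open import Data.Empty using (⊥)
open import Data.Fin.Base using (Fin; zero; suc; toℕ; fromℕ; inject₁)
open import Data.Fin.Induction using (<-weakInduction)
open import Data.Fin.Patterns using (0F; 1F)
open import Data.Fin.Properties using (toℕ-injective; toℕ-fromℕ<; toℕ-fromℕ; toℕ-inject₁; toℕ<n)
open import Data.Fin.Relation.Unary.Top using (view; ‵fromℕ; ‵inject₁)
open import Data.Fin.Subset using (Subset; Side; inside; outside; ∣_∣)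
open import Data.Integer.Base as ℤ using (ℤ; 0ℤ; 1ℤ; -1ℤ)
import Data.Integer.Properties as ℤ
import Data.Integer.Solver
open import Data.List.Base using (List; []; _∷_; _++_; length; map; filter; upTo)
open import Data.List.Membership.Propositional using () renaming (_∈_ to _∈ˡ_)
open import Data.List.Membership.Propositional.Properties using (∈-map⁺; ∈-map⁻; ∈-filter⁺; ∈-filter⁻)
open import Data.List.Membership.Propositional.Properties.WithK using (unique∧set⇒bag)
open import Data.List.Properties
  using (filter-≐; filter-none; filter-++; length-++; length-map; ++-identityʳ; map-upTo; map-applyUpTo)
open import Data.List.Relation.Binary.BagAndSetEquality using (∼bag⇒↭)
open import Data.List.Relation.Binary.Permutation.Propositional.Properties using (↭-length)
open import Data.List.Relation.Unary.All using (universal)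
open import Data.List.Relation.Unary.Unique.Propositional using (Unique)
import Data.List.Relation.Unary.Unique.Propositional.Properties as Unique
open import Data.Nat.Base using (zero; suc; _+_; _*_; _<_; z≤n; s≤s; NonZero; >-nonZero)
open import Data.Nat.Combinatorics using (nC1≡n; k>n⇒nCk≡0; nCk+nC[k+1]≡[n+1]C[k+1])
open import Data.Nat.Divisibility
  using (divides; _∣?_; _∣0; ∣-refl; ∣1⇒≡1; n∣m*n; ∣m+n∣m⇒∣n; ∣m∣n⇒∣m+n)
open import Data.Nat.DivMod using (_%_; m<n⇒m%n≡m; n%n≡0; m*n/n≡m; m/n<m)
open import Data.Nat.ListAction using (product)
open import Data.Nat.Properties
open import Data.Nat.Solver using (module +-*-Solver)
open import Data.Product using (∃; ∃!; _,_; proj₁; proj₂; map₁; map₂)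
open import Data.Rational.Base using (toℚᵘ)
import Data.Rational.Properties as ℚ
import Data.Rational.Unnormalised.Base as ℚᵘ
import Data.Rational.Unnormalised.Properties as ℚᵘ
open import Data.Sum.Base as Sum using (_⊎_; inj₁; inj₂)
open import Data.Unit.Base using (⊤; tt)
open import Data.Vec.Base using (Vec; []; _∷_; lookup; tabulate)
open import Data.Vec.Properties
  using ([]=⇒lookup; lookup⇒[]=; lookup∘tabulate; tabulate∘lookup; tabulate-cong)
open import Function.Base using (_∘_; id; case_of_)
open import Function.Bundles using (mk⇔)
open import Relation.Binary.PropositionalEquality
  using (_≢_; _≗_; refl; sym; trans; cong; cong₂; subst; module ≡-Reasoning)
open import Relation.Nullary using (Dec; yes; no; does; ¬_; contradiction)
open import Relation.Nullary.Decidable using (_×-dec_; dec-true; dec-false)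
open import Relation.Unary using (Decidable; _≐_)

open import Algebra.Properties.AbelianGroup ℤ.+-0-abelianGroup using () renaming (∙-cancelˡ to ℤ-+-cancelˡ)
open import Algebra.Properties.CommutativeMonoid.Sum ℤ.+-0-commutativeMonoid using (sum)

-- Binomial coefficients

-- Pascal's rule and induction on `n`: the copy of `x` split off from `suc (suc k) * x` raises the
-- factor `suc n` to `suc (suc n)`.
absorption : ∀ n k → suc k * (suc n C suc k) ≡ suc n * (n C k)
absorption zero    zero    = refl
absorption zero    (suc k) = trans
  (cong (suc (suc k) *_) (k>n⇒nCk≡0 {1} {suc (suc k)} (s≤s (s≤s z≤n))))
  (*-zeroʳ (suc (suc k)))
absorption (suc n) zero    = trans (*-identityˡ _)
  (trans (nC1≡n (suc (suc n))) (sym (*-identityʳ _)))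
absorption (suc n) (suc k) = begin
  suc (suc k) * (suc (suc n) C suc (suc k))
    ≡⟨ cong (suc (suc k) *_) (nCk+nC[k+1]≡[n+1]C[k+1] (suc n) (suc k)) ⟨
  suc (suc k) * (x + y)
    ≡⟨ solve 3 (λ k x y → (con 2 :+ k) :* (x :+ y) := x :+ ((con 1 :+ k) :* x :+ (con 2 :+ k) :* y)) refl k x y ⟩
  x + (suc k * x + suc (suc k) * y)
    ≡⟨ cong (_+_ x) (cong₂ _+_ (absorption n k) (absorption n (suc k))) ⟩
  x + (suc n * (n C k) + suc n * (n C suc k))
    ≡⟨ cong (_+_ x) (*-distribˡ-+ (suc n) (n C k) (n C suc k)) ⟨
  x + suc n * (n C k + n C suc k)
    ≡⟨ cong (λ z → x + suc n * z) (nCk+nC[k+1]≡[n+1]C[k+1] n k) ⟩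
  suc (suc n) * x ∎
  where
  open ≡-Reasoning
  open +-*-Solver
  x = suc n C suc k
  y = suc n C suc (suc k)

product-shift : ∀ (f : ℕ → ℕ) q →
  product (map f (upTo (suc q))) ≡ f 0 * product (map (λ i → f (suc i)) (upTo q))
product-shift f q = cong (λ xs → f 0 * product xs)
  (trans (map-applyUpTo suc f q) (sym (map-upTo (λ i → f (suc i)) q)))

-- Each use of `absorption` contributes one factor of the falling factorial. When `k` exceeds `n`
-- both sides vanish, the product through its factor `n ∸ n`.
k!*nCk : ∀ n k → k ! * (n C k) ≡ product (map (n ∸_) (upTo k))
k!*nCk n       zero    = refl
k!*nCk zero    (suc k) = trans
  (cong (suc k ! *_) (k>n⇒nCk≡0 {0} {suc k} (s≤s z≤n))) (*-zeroʳ (suc k !))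
k!*nCk (suc n) (suc k) = begin
  suc k * k ! * (suc n C suc k)
    ≡⟨ solve 3 (λ s f c → s :* f :* c := f :* (s :* c)) refl (suc k) (k !) (suc n C suc k) ⟩
  k ! * (suc k * (suc n C suc k))
    ≡⟨ cong (k ! *_) (absorption n k) ⟩
  k ! * (suc n * (n C k))
    ≡⟨ solve 3 (λ s f c → f :* (s :* c) := s :* (f :* c)) refl (suc n) (k !) (n C k) ⟩
  suc n * (k ! * (n C k))
    ≡⟨ cong (suc n *_) (k!*nCk n k) ⟩
  suc n * product (map (n ∸_) (upTo k))
    ≡⟨ product-shift (suc n ∸_) k ⟨
  product (map (suc n ∸_) (upTo (suc k))) ∎
  where
  open ≡-Reasoning
  open +-*-Solver

-- The two summands count the sets avoiding and containing column 0.
cyclicCount : ℕ → ℕ → ℕ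
cyclicCount n zero    = 1
cyclicCount n (suc q) = (n ∸ suc q) C suc q + (n ∸ suc (suc q)) C q

[n∸p]*cyclicCount : ∀ {n p} → p < n → (n ∸ p) * cyclicCount n p ≡ n * ((n ∸ p) C p)
[n∸p]*cyclicCount {n}     {zero}  _   = refl
[n∸p]*cyclicCount {suc n} {suc q} (s≤s q<n) = begin
  N * (c + (n ∸ suc q) C q) ≡⟨ *-distribˡ-+ N c _ ⟩
  N * c + N * ((n ∸ suc q) C q)
    -- `N` is the successor of `n ∸ suc q`, so `absorption` replaces `N` times the second binomial
    -- by `suc q` times the first.
    ≡⟨ cong (_+_ (N * c)) (subst (λ N → N * ((n ∸ suc q) C q) ≡ suc q * (N C suc q)) (sym N≡) (sym (absorption (n ∸ suc q) q))) ⟩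
  N * c + suc q * c   ≡⟨ *-distribʳ-+ c N (suc q) ⟨
  (N + suc q) * c     ≡⟨ cong (_* c) (m∸n+n≡m {suc n} {suc q} (s≤s (<⇒≤ q<n))) ⟩
  suc n * c ∎
  where
  open ≡-Reasoning
  N = n ∸ q
  c = N C suc q
  N≡ : N ≡ suc (n ∸ suc q)
  N≡ = +-∸-assoc 1 q<n

-- After multiplication by `n ∸ p`, which is positive, the left side becomes `n` times a falling
-- factorial with leading factor `n ∸ p`; that factor is then cancelled.
p!*cyclicCount : ∀ {n p} → 1 ≤ p → p < n → p ! * cyclicCount n p ≡ n * fallingProduct n p
p!*cyclicCount {n} {p@(suc q)} _ p<n = *-cancelˡ-≡ _ _ N {{>-nonZero (m<n⇒0<n∸m p<n)}} (begin
  N * (p ! * cyclicCount n p)   ≡⟨ solve 3 (λ N f c → N :* (f :* c) := f :* (N :* c)) refl N (p !) (cyclicCount n p) ⟩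
  p ! * (N * cyclicCount n p)   ≡⟨ cong (p ! *_) ([n∸p]*cyclicCount p<n) ⟩
  p ! * (n * (N C p))           ≡⟨ solve 3 (λ n f c → f :* (n :* c) := n :* (f :* c)) refl n (p !) (N C p) ⟩
  n * (p ! * (N C p))           ≡⟨ cong (n *_) (trans (k!*nCk N p) (product-shift (N ∸_) q)) ⟩
  n * (N * fallingProduct n p)  ≡⟨ solve 3 (λ n N f → n :* (N :* f) := N :* (n :* f)) refl n N (fallingProduct n p) ⟩
  N * (n * fallingProduct n p)  ∎)
  where
  open ≡-Reasoning
  open +-*-Solver
  N = n ∸ p

-- Rationals are stored in lowest terms; over the unnormalised rationals the equation is a cross
-- multiplication of natural numbers.
fromℕℚ-quotient : ∀ x n d y .{{_ : NonZero d}} → d * x ≡ n * y →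
  fromℕℚ x ≡ (+ n ℚ./ d) ℚ.* fromℕℚ y
fromℕℚ-quotient x n d@(suc d-1) y dx≡ny = ℚ.toℚᵘ-injective (begin
  toℚᵘ (fromℕℚ x)
    ≈⟨ ℚ.toℚᵘ-fromℚᵘ (ℚᵘ.mkℚᵘ (+ x) 0) ⟩
  ℚᵘ.mkℚᵘ (+ x) 0
    ≈⟨ ℚᵘ.*≡* cross ⟩
  ℚᵘ.mkℚᵘ (+ n) d-1 ℚᵘ.* ℚᵘ.mkℚᵘ (+ y) 0
    ≈⟨ ℚᵘ.*-cong (ℚ.toℚᵘ-fromℚᵘ (ℚᵘ.mkℚᵘ (+ n) d-1)) (ℚ.toℚᵘ-fromℚᵘ (ℚᵘ.mkℚᵘ (+ y) 0)) ⟨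
  toℚᵘ (+ n ℚ./ d) ℚᵘ.* toℚᵘ (fromℕℚ y)
    ≈⟨ ℚ.toℚᵘ-homo-* (+ n ℚ./ d) (fromℕℚ y) ⟨
  toℚᵘ ((+ n ℚ./ d) ℚ.* fromℕℚ y) ∎)
  where
  open import Relation.Binary.Reasoning.Setoid ℚᵘ.≃-setoid
  cross : + x ℤ.* + (d * 1) ≡ (+ n ℤ.* + y) ℤ.* + 1
  cross = trans (sym (ℤ.pos-* x (d * 1))) (trans (cong +_ (trans (cong (x *_) (*-identityʳ d)) (trans (*-comm x d) dx≡ny)))
     (trans (ℤ.pos-* n y) (sym (ℤ.*-identityʳ _))))

-- Counting cyclically independent sets

count : {A : Set} {P : A → Set} → Decidable P → List A → ℕ
count P? xs = length (filter P? xs)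

module _ {A : Set} {P : A → Set} (P? : Decidable P) where

  count-++ : ∀ xs ys → count P? (xs ++ ys) ≡ count P? xs + count P? ys
  count-++ xs ys = trans (cong length (filter-++ P? xs ys)) (length-++ (filter P? xs))

  count-map : {B : Set} (f : B → A) → ∀ ys → count P? (map f ys) ≡ count (P? ∘ f) ys
  count-map f []       = refl
  count-map f (y ∷ ys) with does (P? (f y))
  ... | true  = cong suc (count-map f ys)
  ... | false = count-map f ys

  count-none : (∀ x → ¬ P x) → ∀ xs → count P? xs ≡ 0
  count-none ¬P xs = cong length (filter-none P? (universal ¬P xs))

  count-≐ : {Q : A → Set} (Q? : Decidable Q) → P ≐ Q → ∀ xs → count P? xs ≡ count Q? xs
  count-≐ Q? P≐Q xs = cong length (filter-≐ P? Q? P≐Q xs)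

numberOfSize : ∀ {m} {P : Subset m → Set} → Decidable P → ℕ → ℕ
numberOfSize {m} P? p = count (λ S → P? S ×-dec (∣ S ∣ ≟ p)) (vecs sides m)

count-vecs : ∀ {m} {P : Subset (suc m) → Set} (P? : Decidable P) →
  count P? (vecs sides (suc m)) ≡
  count (P? ∘ (outside ∷_)) (vecs sides m) + count (P? ∘ (inside ∷_)) (vecs sides m)
count-vecs {m} P? = begin
  -- `vecs sides (suc m)` unfolds to this concatenation; the trailing `[]` ends the recursion over
  -- `sides`.
  count P? (map (outside ∷_) xs ++ map (inside ∷_) xs ++ [])
    ≡⟨ cong (λ ys → count P? (map (outside ∷_) xs ++ ys)) (++-identityʳ _) ⟩
  count P? (map (outside ∷_) xs ++ map (inside ∷_) xs)
    ≡⟨ count-++ P? (map (outside ∷_) xs) _ ⟩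
  count P? (map (outside ∷_) xs) + count P? (map (inside ∷_) xs)
    ≡⟨ cong₂ _+_ (count-map P? _ xs) (count-map P? _ xs) ⟩
  count (P? ∘ (outside ∷_)) xs + count (P? ∘ (inside ∷_)) xs ∎
  where
  open ≡-Reasoning
  xs = vecs sides m

numberOfSize-≐ : ∀ m {P Q : Subset m → Set} (P? : Decidable P) (Q? : Decidable Q) →
  P ≐ Q → ∀ p → numberOfSize P? p ≡ numberOfSize Q? p
numberOfSize-≐ m P? Q? (P⊆Q , Q⊆P) p = count-≐ _ _ (map₁ P⊆Q , map₁ Q⊆P) (vecs sides m)

module _ m {P : Subset (suc m) → Set} (P? : Decidable P) where

  numberOfSize-zero : numberOfSize P? 0 ≡ numberOfSize (P? ∘ (outside ∷_)) 0
  numberOfSize-zero = begin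
    numberOfSize P? 0
      ≡⟨ count-vecs (λ S → P? S ×-dec (∣ S ∣ ≟ 0)) ⟩
    numberOfSize (P? ∘ (outside ∷_)) 0 + _
      ≡⟨ cong (_+_ (numberOfSize (P? ∘ (outside ∷_)) 0))
           (count-none (λ S → P? (inside ∷ S) ×-dec (suc ∣ S ∣ ≟ 0)) (λ { _ (_ , ()) }) (vecs sides m)) ⟩
    numberOfSize (P? ∘ (outside ∷_)) 0 + 0
      ≡⟨ +-identityʳ _ ⟩
    numberOfSize (P? ∘ (outside ∷_)) 0 ∎
    where open ≡-Reasoning

  numberOfSize-suc : ∀ p → numberOfSize P? (suc p) ≡
    numberOfSize (P? ∘ (outside ∷_)) (suc p) + numberOfSize (P? ∘ (inside ∷_)) p
  numberOfSize-suc p = trans (count-vecs (λ S → P? S ×-dec (∣ S ∣ ≟ suc p)))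
    (cong (_+_ (numberOfSize (P? ∘ (outside ∷_)) (suc p)))
      (count-≐ _ _ (map₂ suc-injective , map₂ (cong suc)) (vecs sides m)))

-- Words without two neighbouring `inside` letters

NotBoth : Side → Side → Set
NotBoth inside  inside  = ⊥
NotBoth inside  outside = ⊤
NotBoth outside _       = ⊤

notBoth? : ∀ s t → Dec (NotBoth s t)
notBoth? inside  inside  = no id
notBoth? inside  outside = yes tt
notBoth? outside t       = yes tt

-- t is the letter that follows the word, s the one that precedes it.
Path : Side → Side → ∀ {m} → Subset m → Set
Path t s []       = NotBoth s t
Path t s (x ∷ xs) = NotBoth s x × Path t x xs

path? : ∀ t s {m} → Decidable (Path t s {m})
path? t s []       = notBoth? s t
path? t s (x ∷ xs) = notBoth? s x ×-dec path? t x xs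

-- The cycle is closed by letting the first letter both precede and follow the rest of the word.
Independent : ∀ {n} → Subset n → Set
Independent []       = ⊤
Independent (x ∷ xs) = Path x x xs

independent? : ∀ {n} → Decidable (Independent {n})
independent? []       = yes tt
independent? (x ∷ xs) = path? x x xs

paths : Side → Side → ℕ → ℕ → ℕ
paths t s m p = numberOfSize (path? t s {m}) p

paths-tail : ∀ t s x m p → NotBoth s x →
  numberOfSize (path? t s {suc m} ∘ (x ∷_)) p ≡ paths t x m p
paths-tail t s x m p ok = numberOfSize-≐ m (path? t s ∘ (x ∷_)) (path? t x) (proj₂ , (ok ,_)) p

paths-outside-zero : ∀ t m → paths t outside (suc m) 0 ≡ paths t outside m 0
paths-outside-zero t m =
  trans (numberOfSize-zero m (path? t outside)) (paths-tail t outside outside m 0 tt)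

paths-outside-suc : ∀ t m p →
  paths t outside (suc m) (suc p) ≡ paths t outside m (suc p) + paths t inside m p
paths-outside-suc t m p = trans (numberOfSize-suc m (path? t outside) p)
  (cong₂ _+_ (paths-tail t outside outside m (suc p) tt) (paths-tail t outside inside m p tt))

paths-inside : ∀ t m p → paths t inside (suc m) p ≡ paths t outside m p
paths-inside t m zero    =
  trans (numberOfSize-zero m (path? t inside)) (paths-tail t inside outside m 0 tt)
paths-inside t m (suc p) = trans (numberOfSize-suc m (path? t inside) p)
  (trans (cong₂ _+_ (paths-tail t inside outside m (suc p) tt)
                    (count-none (λ S → path? t inside (inside ∷ S) ×-dec (∣ S ∣ ≟ p)) (λ { _ ((() , _) , _) }) (vecs sides m)))
         (+-identityʳ _))

-- For `p ≤ m` this is Pascal's rule. Beyond that the truncated differences are zero and the lower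
-- indices positive, so every term is zero.
truncated-pascal : ∀ m p → (m ∸ p) C suc p + (m ∸ p) C p ≡ (suc m ∸ p) C suc p
truncated-pascal m p with p ≤? m
... | yes p≤m = trans (+-comm ((m ∸ p) C suc p) _)
  (trans (nCk+nC[k+1]≡[n+1]C[k+1] (m ∸ p) p) (cong (_C suc p) (sym (+-∸-assoc 1 p≤m))))
... | no  p≰m with suc q ← p | s≤s m≤q ← ≰⇒> p≰m
  rewrite m≤n⇒m∸n≡0 m≤q | m≤n⇒m∸n≡0 (m≤n⇒m≤1+n m≤q) = refl

mutual
  -- `outside` ends impose no condition, so this is the classical count of `p` pairwise nonadjacent
  -- places among `m`. Splitting on the first letter gives Pascal's recursion; an `inside` letter
  -- forces the next one to be `outside`.
  paths-outside-outside : ∀ m p → paths outside outside m p ≡ (suc m ∸ p) C p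
  paths-outside-outside zero    zero    = refl
  paths-outside-outside zero    (suc p) rewrite 0∸n≡0 p = refl
  paths-outside-outside (suc m) zero    = trans (paths-outside-zero outside m) (paths-outside-outside m zero)
  paths-outside-outside (suc m) (suc p) = trans (paths-outside-suc outside m p)
    (trans (cong₂ _+_ (paths-outside-outside m (suc p)) (paths-outside-inside m p)) (truncated-pascal m p))

  paths-outside-inside : ∀ m p → paths outside inside m p ≡ (m ∸ p) C p
  paths-outside-inside zero    zero    = refl
  paths-outside-inside zero    (suc p) = refl
  paths-outside-inside (suc m) p       = trans (paths-inside outside m p) (paths-outside-outside m p)

mutual
  -- The mirror image of `paths-outside-inside`. The recursion still runs from the first letter, so
  -- the count with both ends `inside` enters.
  paths-inside-outside : ∀ m p → paths inside outside m p ≡ (m ∸ p) C p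
  paths-inside-outside zero    zero    = refl
  paths-inside-outside zero    (suc p) = refl
  paths-inside-outside (suc m) zero    = trans (paths-outside-zero inside m) (paths-inside-outside m zero)
  -- Length one is treated apart: its `inside` branch is the empty word between two `inside`
  -- letters, which `paths-inside-inside` does not cover.
  paths-inside-outside (suc zero) (suc zero) = refl
  paths-inside-outside (suc zero) (suc (suc p)) = refl
  paths-inside-outside (suc (suc m)) (suc p) = trans (paths-outside-suc inside (suc m) p)
    (trans (cong₂ _+_ (paths-inside-outside (suc m) (suc p)) (paths-inside-inside m p)) (truncated-pascal m p))

  paths-inside-inside : ∀ m p → paths inside inside (suc m) p ≡ (m ∸ p) C p
  paths-inside-inside m p = trans (paths-inside inside m p) (paths-inside-outside m p)

-- An `outside` first letter gives the tail two `outside` ends; an `inside` one gives it two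
-- `inside` ends and one letter fewer to place. The tail is nonempty because `2 ≤ n`.
independents-cyclicCount : ∀ n p → 2 ≤ n → numberOfSize (independent? {n}) p ≡ cyclicCount n p
independents-cyclicCount (suc (suc m)) zero    (s≤s (s≤s _)) =
  trans (numberOfSize-zero (suc m) independent?) (paths-outside-outside (suc m) 0)
independents-cyclicCount (suc (suc m)) (suc p) (s≤s (s≤s _)) =
  trans (numberOfSize-suc (suc m) independent? p) (cong₂ _+_ (paths-outside-outside (suc m) (suc p)) (paths-inside-inside m p))

-- Perfect matchings of the strip of hexagons

-- Defined by cases rather than through `mod`, so that adjacent columns appear as `inject₁ i` and
-- `suc i`, the form that suits inductions over vectors and over `Fin`.
prev : ∀ {n} → Fin n → Fin n
prev {suc m} zero    = fromℕ m
prev {suc m} (suc i) = inject₁ i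

next-prev : ∀ {n} (j : Fin n) → next (prev j) ≡ j
next-prev {suc m} zero    = toℕ-injective (trans (toℕ-fromℕ< _)
  (trans (cong (λ k → suc k % suc m) (toℕ-fromℕ m)) (n%n≡0 (suc m))))
next-prev {suc m} (suc i) = toℕ-injective (trans (toℕ-fromℕ< _)
  (trans (cong (λ k → suc k % suc m) (toℕ-inject₁ i)) (m<n⇒m%n≡m (s≤s (toℕ<n i)))))

prev-surjective : ∀ {n} (j : Fin n) → ∃ λ i → prev i ≡ j
prev-surjective {suc m} j with view j
... | ‵fromℕ     = zero , refl
... | ‵inject₁ i = suc i , refl

prev-next : ∀ {n} (j : Fin n) → prev (next j) ≡ j
prev-next j with i , refl ← prev-surjective j = cong prev (next-prev i)

inject₁≢suc : ∀ {n} (i : Fin n) → inject₁ i ≢ suc i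
inject₁≢suc zero    ()
inject₁≢suc (suc i) e with inject₁ i | inject₁≢suc i
inject₁≢suc (suc i) refl | _ | ne = ne refl

-- Keeps the left and right edges of a node distinct; with a single column they would be the same
-- loop.
prev≢id : ∀ {n} → 2 ≤ n → (j : Fin n) → prev j ≢ j
prev≢id (s≤s (s≤s _)) zero    ()
prev≢id (s≤s (s≤s _)) (suc i) = inject₁≢suc i

odd-suc : ∀ {k} → ¬ 2 ∣ k → 2 ∣ suc k
odd-suc {zero}        2∤k = contradiction (2 ∣0) 2∤k
odd-suc {suc zero}    2∤k = ∣-refl
odd-suc {suc (suc k)} 2∤k = ∣m∣n⇒∣m+n ∣-refl (odd-suc (2∤k ∘ ∣m∣n⇒∣m+n ∣-refl))

even-suc : ∀ {k} → 2 ∣ k → ¬ 2 ∣ suc k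
even-suc {k} 2∣k 2∣1+k
  with () ← ∣1⇒≡1 (∣m+n∣m⇒∣n (subst (2 ∣_) (+-comm 1 k) 2∣1+k) 2∣k)

-- Colours alternate within a column, so exactly one of its two vertical edges survives: the one
-- going up from the black node.
blackRow : ∀ {n} → Fin n → Fin 2
blackRow j = if does (2 ∣? toℕ j) then 0F else 1F

black⇒blackRow : ∀ {n} r (j : Fin n) → Black (r , j) → blackRow j ≡ r
black⇒blackRow 0F j b rewrite dec-true (2 ∣? toℕ j) b = refl
black⇒blackRow 1F j b rewrite dec-false (2 ∣? toℕ j) (λ e → even-suc e b) = refl

blackRow-black : ∀ {n} (j : Fin n) → Black (blackRow j , j)
blackRow-black j with 2 ∣? toℕ j
... | yes 2∣j = subst (λ r → Black (r , j)) (sym (black⇒blackRow 0F j 2∣j)) 2∣j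
... | no  2∤j = subst (λ r → Black (r , j)) (sym (black⇒blackRow 1F j (odd-suc 2∤j))) (odd-suc 2∤j)

rows-adjacent : (r s : Fin 2) → s ≡ r ⊎ next s ≡ r
rows-adjacent 0F 0F = inj₁ refl
rows-adjacent 0F 1F = inj₂ refl
rows-adjacent 1F 0F = inj₂ refl
rows-adjacent 1F 1F = inj₁ refl

side : ∀ {n} → EdgeSet n → Edge n → Side
side (H , V) (h r j) = lookup (lookup H r) j
side (H , V) (v r j) = lookup (lookup V r) j

module _ {n} (M : EdgeSet n) where

  ∈⇒inside : ∀ e → e ∈ M → side M e ≡ inside
  ∈⇒inside (h r j) = []=⇒lookup
  ∈⇒inside (v r j) = []=⇒lookup

  inside⇒∈ : ∀ e → side M e ≡ inside → e ∈ M
  inside⇒∈ (h r j) = lookup⇒[]= j _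
  inside⇒∈ (v r j) = lookup⇒[]= j _

  does-∈? : ∀ e → does (e ∈? M) ≡ side M e
  does-∈? e with side M e in eq
  ... | inside  = dec-true (e ∈? M) (inside⇒∈ e eq)
  ... | outside = dec-false (e ∈? M) λ e∈M → case-absurd (trans (sym (∈⇒inside e e∈M)) eq)
    where
    case-absurd : inside ≢ outside
    case-absurd ()

data ExactlyOne : Side → Side → Side → Set where
  first  : ExactlyOne inside  outside outside
  second : ExactlyOne outside inside  outside
  third  : ExactlyOne outside outside inside

left right rung : ∀ {n} → Node n → Edge n
left  (r , j) = h r (prev j)
right (r , j) = h r j
rung  (r , j) = v (blackRow j) j

left-touches : ∀ {n} (x : Node n) → Touches (left x) x
left-touches (r , j) = inj₂ (cong (r ,_) (next-prev j))

rung-touches : ∀ {n} (x : Node n) → Touches (rung x) x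
rung-touches (r , j) = Sum.map (cong (_, j)) (cong (_, j)) (rows-adjacent r (blackRow j))

-- A kept vertical edge starts at the black node of its column, so it is the `rung` of either of its
-- ends.
touching : ∀ {n} (x : Node n) e → InHexagons e → Touches e x → e ≡ left x ⊎ e ≡ right x ⊎ e ≡ rung x
touching x (h r k) _ (inj₁ refl) = inj₂ (inj₁ refl)
touching x (h r k) _ (inj₂ refl) = inj₁ (cong (h r) (sym (prev-next k)))
touching x (v r k) b (inj₁ refl) = inj₂ (inj₂ (cong (λ s → v s k) (sym (black⇒blackRow r k b))))
touching x (v r k) b (inj₂ refl) = inj₂ (inj₂ (cong (λ s → v s k) (sym (black⇒blackRow r k b))))

-- Perfect matching as a Boolean condition at each node; by `touching`, only these three edges can
-- cover it.
record Local {n} (M : EdgeSet n) : Set where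
  field
    kept  : ∀ e → e ∈ M → InHexagons e
    local : ∀ x → ExactlyOne (side M (left x)) (side M (right x)) (side M (rung x))

module _ {n} {M : EdgeSet n} where

  perfect⇒local : 2 ≤ n → PerfectMatching M → Local M
  perfect⇒local 2≤n (kept , unique) = record { kept = kept ; local = local }
    where
    agree : ∀ x e f → Touches e x → Touches f x → side M e ≡ inside → side M f ≡ inside → e ≡ f
    agree x e f te tf e-in f-in with g , _ , g! ← unique x =
      trans (sym (g! (inside⇒∈ M e e-in , te))) (g! (inside⇒∈ M f f-in , tf))

    left≢right : ∀ x → left x ≢ right x
    left≢right (r , j) e with prev j | prev≢id 2≤n j
    left≢right (r , j) refl | _ | ne = ne refl

    local : ∀ x → ExactlyOne (side M (left x)) (side M (right x)) (side M (rung x))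
    local x with side M (left x) in l | side M (right x) in r | side M (rung x) in v
    ... | inside  | outside | outside = first
    ... | outside | inside  | outside = second
    ... | outside | outside | inside  = third
    -- Two chosen edges at `x` would coincide, but the horizontal ones have different column indices
    -- and a rung is never horizontal.
    ... | inside  | inside  | _       =
      contradiction (agree x (left x) (right x) (left-touches x) (inj₁ refl) l r) (left≢right x)
    ... | inside  | outside | inside
      with () ← agree x (left x) (rung x) (left-touches x) (rung-touches x) l v
    ... | outside | inside  | inside
      with () ← agree x (right x) (rung x) (inj₁ refl) (rung-touches x) r v
    -- Some edge of `M` covers `x`, yet each of the three candidates is absent.
    ... | outside | outside | outside
      with e , (e∈M , te) , _ ← unique x
      with touching x e (kept e e∈M) te
    ... | inj₁ refl        with () ← trans (sym l) (∈⇒inside M (left x) e∈M)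
    ... | inj₂ (inj₁ refl) with () ← trans (sym r) (∈⇒inside M (right x) e∈M)
    ... | inj₂ (inj₂ refl) with () ← trans (sym v) (∈⇒inside M (rung x) e∈M)

  local⇒perfect : Local M → PerfectMatching M
  local⇒perfect record { kept = kept ; local = local } = kept , unique
    where
    unique : ∀ x → ∃! _≡_ λ e → e ∈ M × Touches e x
    absent : ∀ {A : Set} e → side M e ≡ outside → e ∈ M → A
    absent e e-out e∈M with () ← trans (sym e-out) (∈⇒inside M e e∈M)

    unique x with side M (left x) in l | side M (right x) in r | side M (rung x) in v | local x
    ... | _ | _ | _ | first  = left x , (inside⇒∈ M (left x) l , left-touches x) , λ {e} (e∈M , te) →
      case touching x e (kept e e∈M) te of λ where
        (inj₁ refl)        → refl
        (inj₂ (inj₁ refl)) → absent (right x) r e∈M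
        (inj₂ (inj₂ refl)) → absent (rung x) v e∈M
    ... | _ | _ | _ | second = right x , (inside⇒∈ M (right x) r , inj₁ refl) , λ {e} (e∈M , te) →
      case touching x e (kept e e∈M) te of λ where
        (inj₁ refl)        → absent (left x) l e∈M
        (inj₂ (inj₁ refl)) → refl
        (inj₂ (inj₂ refl)) → absent (rung x) v e∈M
    ... | _ | _ | _ | third  = rung x , (inside⇒∈ M (rung x) v , rung-touches x) , λ {e} (e∈M , te) →
      case touching x e (kept e e∈M) te of λ where
        (inj₁ refl)        → absent (left x) l e∈M
        (inj₂ (inj₁ refl)) → absent (right x) r e∈M
        (inj₂ (inj₂ refl)) → refl

contribution-side : ∀ {n} (M : EdgeSet n) e →
  contribution M e ≡ (if side M e then sign (proj₁ (ends e)) else 0ℤ)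
contribution-side M e = cong (if_then sign (proj₁ (ends e)) else 0ℤ) (does-∈? M e)

sign-black : ∀ {n} (x : Node n) → Black x → sign x ≡ 1ℤ
sign-black x b = cong (if_then 1ℤ else -1ℤ) (dec-true (black? x) b)

sign-white : ∀ {n} (x : Node n) → ¬ Black x → sign x ≡ -1ℤ
sign-white x w = cong (if_then 1ℤ else -1ℤ) (dec-false (black? x) w)

-- The weights

indicator : Side → ℤ
indicator s = if s then 1ℤ else 0ℤ

-- `suc k * 2` reduces to two successors, so a sum over `Fin (k * 2)` peels off an even and an odd
-- column at a time.
evenColumn oddColumn : ∀ {k} → Fin k → Fin (k * 2)
evenColumn zero    = zero
evenColumn (suc i) = suc (suc (evenColumn i))
oddColumn zero    = suc zero
oddColumn (suc i) = suc (suc (oddColumn i))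

2∣evenColumn : ∀ {k} (i : Fin k) → 2 ∣ toℕ (evenColumn i)
2∣evenColumn zero    = 2 ∣0
2∣evenColumn (suc i) = ∣m∣n⇒∣m+n ∣-refl (2∣evenColumn i)

2∣suc-oddColumn : ∀ {k} (i : Fin k) → 2 ∣ suc (toℕ (oddColumn i))
2∣suc-oddColumn zero    = ∣-refl
2∣suc-oddColumn (suc i) = ∣m∣n⇒∣m+n ∣-refl (2∣suc-oddColumn i)

inject₁-oddColumn : ∀ {k} (i : Fin k) → inject₁ (oddColumn i) ≡ suc (evenColumn i)
inject₁-oddColumn zero    = refl
inject₁-oddColumn (suc i) = cong (λ j → suc (suc j)) (inject₁-oddColumn i)

prev-oddColumn : ∀ {k} (i : Fin k) → prev (oddColumn i) ≡ evenColumn i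
prev-oddColumn zero    = refl
prev-oddColumn (suc i) = cong suc (inject₁-oddColumn i)

∣x∷S∣≡indicator+∣S∣ : ∀ x {n} (S : Subset n) → + ∣ x ∷ S ∣ ≡ indicator x ℤ.+ + ∣ S ∣
∣x∷S∣≡indicator+∣S∣ inside  S = refl
∣x∷S∣≡indicator+∣S∣ outside S = refl

-- Column `2i + 1` lies between the gaps `2i` and `2i + 1`, so each gap is subtracted once from a
-- total of `k` ones.
sum-oddColumns : ∀ k (S : Subset (k * 2)) (c : Fin (k * 2) → ℤ) →
  (∀ (i : Fin k) → c (evenColumn i) ≡ 0ℤ) →
  (∀ (i : Fin k) → c (oddColumn i) ≡
    1ℤ ℤ.- indicator (lookup S (evenColumn i)) ℤ.- indicator (lookup S (oddColumn i))) →
  sum c ≡ + k ℤ.- + ∣ S ∣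
sum-oddColumns zero    []          c _     _    = refl
sum-oddColumns (suc k) (x ∷ y ∷ S) c even odd = begin
  c zero ℤ.+ (c (suc zero) ℤ.+ sum (λ i → c (suc (suc i))))
    ≡⟨ cong₂ ℤ._+_ (even zero) (cong₂ ℤ._+_ (odd zero)
         (sum-oddColumns k S (λ j → c (suc (suc j))) (λ i → even (suc i)) (λ i → odd (suc i)))) ⟩
  0ℤ ℤ.+ (1ℤ ℤ.- indicator x ℤ.- indicator y ℤ.+ (+ k ℤ.- + ∣ S ∣))
    ≡⟨ solve 4 (λ x y k s → con 0ℤ :+ (con 1ℤ :- x :- y :+ (k :- s)) := con 1ℤ :+ k :- (x :+ (y :+ s)))
         refl (indicator x) (indicator y) (+ k) (+ ∣ S ∣) ⟩
  1ℤ ℤ.+ + k ℤ.- (indicator x ℤ.+ (indicator y ℤ.+ + ∣ S ∣))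
    ≡⟨ cong (ℤ._-_ (+ suc k)) (trans (∣x∷S∣≡indicator+∣S∣ x (y ∷ S)) (cong (ℤ._+_ (indicator x)) (∣x∷S∣≡indicator+∣S∣ y S))) ⟨
  + suc k ℤ.- + ∣ x ∷ y ∷ S ∣ ∎
  where
  open ≡-Reasoning
  open Data.Integer.Solver.+-*-Solver

exactlyOne-indicator : ∀ {x y z} → ExactlyOne x y z → indicator z ≡ 1ℤ ℤ.- indicator x ℤ.- indicator y
exactlyOne-indicator first  = refl
exactlyOne-indicator second = refl
exactlyOne-indicator third  = refl

white-outside : ∀ {n} {M : EdgeSet n} → Local M → ∀ r j → ¬ Black (r , j) → side M (v r j) ≡ outside
white-outside {M = M} loc r j white with side M (v r j) in eq
... | outside = refl
... | inside  = contradiction (Local.kept loc (v r j) (inside⇒∈ M (v r j) eq)) white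

-- `(1F , j)` is black only for odd `j`. There the edge crossing `z` is the rung of the column; it
-- counts positively and is present exactly when both gaps beside it are empty in the bottom row.
zWeight-local : ∀ k (M : EdgeSet (k * 2)) → Local M →
  zWeight M ≡ + k ℤ.- + ∣ lookup (proj₁ M) 0F ∣
zWeight-local k M loc = sum-oddColumns k (lookup (proj₁ M) 0F) (λ j → contribution M (v 1F j)) even odd
  where
  open ≡-Reasoning
  even : ∀ (i : Fin k) → contribution M (v 1F (evenColumn i)) ≡ 0ℤ
  even i = trans (contribution-side M (v 1F (evenColumn i)))
    (cong (if_then sign (1F , evenColumn i) else 0ℤ) (white-outside loc 1F (evenColumn i) (even-suc (2∣evenColumn i))))

  odd : ∀ (i : Fin k) → contribution M (v 1F (oddColumn i)) ≡
    1ℤ ℤ.- indicator (lookup (lookup (proj₁ M) 0F) (evenColumn i))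
       ℤ.- indicator (lookup (lookup (proj₁ M) 0F) (oddColumn i))
  odd i = begin
    contribution M (v 1F j)
      ≡⟨ contribution-side M (v 1F j) ⟩
    (if side M (v 1F j) then sign (1F , j) else 0ℤ)
      ≡⟨ cong (if side M (v 1F j) then_else 0ℤ) (sign-black (1F , j) (2∣suc-oddColumn i)) ⟩
    indicator (side M (v 1F j))
      ≡⟨ cong (λ r → indicator (side M (v r j))) (black⇒blackRow 1F j (2∣suc-oddColumn i)) ⟨
    indicator (side M (rung (0F , j)))
      ≡⟨ exactlyOne-indicator (Local.local loc (0F , j)) ⟩
    1ℤ ℤ.- indicator (side M (h 0F (prev j))) ℤ.- indicator (side M (h 0F j))
      ≡⟨ cong (λ i → 1ℤ ℤ.- indicator (side M (h 0F i)) ℤ.- indicator (side M (h 0F j))) (prev-oddColumn i) ⟩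
    1ℤ ℤ.- indicator (side M (h 0F (evenColumn i))) ℤ.- indicator (side M (h 0F j)) ∎
    where j = oddColumn i

-- The last column is odd, so its upper node is black and its lower node white: the two edges
-- crossing `w` carry opposite signs.
wWeight≡lastGap : ∀ {m} → ¬ 2 ∣ m → (M : EdgeSet (suc m)) →
  wWeight M ≡ indicator (side M (h 1F (fromℕ m))) ℤ.- indicator (side M (h 0F (fromℕ m)))
wWeight≡lastGap {m} 2∤m M
  rewrite contribution-side M (h 0F (fromℕ m)) | contribution-side M (h 1F (fromℕ m))
        | sign-white (0F , fromℕ m) (2∤m ∘ subst (2 ∣_) (toℕ-fromℕ m))
        | sign-black (1F , fromℕ m) (subst (λ k → 2 ∣ suc k) (sym (toℕ-fromℕ m)) (odd-suc 2∤m))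
  with side M (h 0F (fromℕ m)) | side M (h 1F (fromℕ m))
... | inside  | inside  = refl
... | inside  | outside = refl
... | outside | inside  = refl
... | outside | outside = refl

indicator-injective : ∀ {s t} → indicator s ≡ indicator t → s ≡ t
indicator-injective {inside}  {inside}  _ = refl
indicator-injective {outside} {outside} _ = refl

-- Matchings with n_w = 0 as independent sets of gaps

NeighboursNotBoth : ∀ {n} → Subset n → Set
NeighboursNotBoth S = ∀ j → NotBoth (lookup S (prev j)) (lookup S j)

-- Turns the recursive condition into a pointwise one. For `s` and `t` both the first letter of a
-- cyclic word, the two components are the conditions at column zero and at the columns `suc i`.
path⇒neighbours : ∀ t s {m} (S : Subset m) → Path t s S →
  NotBoth (lookup (s ∷ S) (fromℕ m)) t ×
  (∀ i → NotBoth (lookup (s ∷ S) (inject₁ i)) (lookup S i))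
path⇒neighbours t s []      st         = st , λ ()
path⇒neighbours t s (x ∷ S) (sx , path) with last , steps ← path⇒neighbours t x S path =
  last , λ { zero → sx ; (suc i) → steps i }

neighbours⇒path : ∀ t s {m} (S : Subset m) →
  NotBoth (lookup (s ∷ S) (fromℕ m)) t →
  (∀ i → NotBoth (lookup (s ∷ S) (inject₁ i)) (lookup S i)) → Path t s S
neighbours⇒path t s []      last _     = last
neighbours⇒path t s (x ∷ S) last steps =
  steps zero , neighbours⇒path t x S last (λ i → steps (suc i))

independent⇒neighbours : ∀ {n} (S : Subset n) → Independent S → NeighboursNotBoth S
independent⇒neighbours (x ∷ S) path zero    = proj₁ (path⇒neighbours x x S path)
independent⇒neighbours (x ∷ S) path (suc i) = proj₂ (path⇒neighbours x x S path) i

neighbours⇒independent : ∀ {n} (S : Subset n) → NeighboursNotBoth S → Independent S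
neighbours⇒independent []      _ = tt
neighbours⇒independent (x ∷ S) N = neighbours⇒path x x S (N zero) (λ i → N (suc i))

rungSide : ∀ {n} → Subset n → Fin 2 → Fin n → Side
rungSide S r j = if does (black? (r , j)) then not (lookup S (prev j) ∨ lookup S j) else outside

rungSide-black : ∀ {n} (S : Subset n) r j → Black (r , j) →
  rungSide S r j ≡ not (lookup S (prev j) ∨ lookup S j)
rungSide-black S r j b =
  cong (if_then not (lookup S (prev j) ∨ lookup S j) else outside) (dec-true (black? (r , j)) b)

rungSide-white : ∀ {n} (S : Subset n) r j → ¬ Black (r , j) → rungSide S r j ≡ outside
rungSide-white S r j w =
  cong (if_then not (lookup S (prev j) ∨ lookup S j) else outside) (dec-false (black? (r , j)) w)

-- For even `n ≥ 2` and independent `S`, this is the only perfect matching of zero `w`-weight whose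
-- bottom row is `S`.
doubling : ∀ {n} → Subset n → EdgeSet n
doubling S = (S ∷ S ∷ []) , tabulate λ r → tabulate (rungSide S r)

side-doubling-h : ∀ {n} (S : Subset n) r j → side (doubling S) (h r j) ≡ lookup S j
side-doubling-h S 0F j = refl
side-doubling-h S 1F j = refl

side-doubling-v : ∀ {n} (S : Subset n) r j → side (doubling S) (v r j) ≡ rungSide S r j
side-doubling-v S r j = trans
  (cong (λ R → lookup R j) (lookup∘tabulate (λ r → tabulate (rungSide S r)) r))
  (lookup∘tabulate (rungSide S r) j)

exactlyOne-nor : ∀ s t → NotBoth s t → ExactlyOne s t (not (s ∨ t))
exactlyOne-nor inside  outside _ = first
exactlyOne-nor outside inside  _ = second
exactlyOne-nor outside outside _ = third

exactlyOne⇒notBoth : ∀ {x y z} → ExactlyOne x y z → NotBoth x y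
exactlyOne⇒notBoth first  = tt
exactlyOne⇒notBoth second = tt
exactlyOne⇒notBoth third  = tt

exactlyOne⇒nor : ∀ {x y z} → ExactlyOne x y z → z ≡ not (x ∨ y)
exactlyOne⇒nor first  = refl
exactlyOne⇒nor second = refl
exactlyOne⇒nor third  = refl

-- Carries agreement of the rows across a column: its two nodes share the rung `z`, so equal left
-- edges force equal right edges.
exactlyOne-second-unique : ∀ {x y y′ z} → ExactlyOne x y z → ExactlyOne x y′ z → y ≡ y′
exactlyOne-second-unique first  first  = refl
exactlyOne-second-unique second second = refl
exactlyOne-second-unique third  third  = refl

doubling-local : ∀ {n} (S : Subset n) → NeighboursNotBoth S → Local (doubling S)
doubling-local S N = record { kept = kept ; local = local }
  where
  kept : ∀ e → e ∈ doubling S → InHexagons e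
  kept (h r j) _   = tt
  kept (v r j) v∈ with black? (r , j)
  ... | yes b = b
  ... | no  w with () ← trans (sym (∈⇒inside (doubling S) (v r j) v∈))
                          (trans (side-doubling-v S r j) (rungSide-white S r j w))

  local : ∀ x → ExactlyOne (side (doubling S) (left x)) (side (doubling S) (right x)) (side (doubling S) (rung x))
  local (r , j)
    rewrite side-doubling-h S r (prev j) | side-doubling-h S r j
          | side-doubling-v S (blackRow j) j
          | dec-true (black? (blackRow j , j)) (blackRow-black j)
    = exactlyOne-nor (lookup S (prev j)) (lookup S j) (N j)

lookup-injective : ∀ {A : Set} {n} {xs ys : Vec A n} → lookup xs ≗ lookup ys → xs ≡ ys
lookup-injective {xs = xs} {ys} eq =
  trans (sym (tabulate∘lookup xs)) (trans (tabulate-cong eq) (tabulate∘lookup ys))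

module _ {m} (2∤m : ¬ 2 ∣ m) {M : EdgeSet (suc m)} (loc : Local M) (w≡0 : wWeight M ≡ 0ℤ) where

  open Local loc

  rows-agree-last : side M (h 0F (fromℕ m)) ≡ side M (h 1F (fromℕ m))
  rows-agree-last = sym (indicator-injective (ℤ.i-j≡0⇒i≡j _ _ (trans (sym (wWeight≡lastGap 2∤m M)) w≡0)))

  rows-agree-next : ∀ j → side M (h 0F (prev j)) ≡ side M (h 1F (prev j)) → side M (h 0F j) ≡ side M (h 1F j)
  rows-agree-next j eq = exactlyOne-second-unique (local (0F , j))
    (subst (λ s → ExactlyOne s (side M (h 1F j)) (side M (rung (1F , j)))) (sym eq) (local (1F , j)))

  rows-agree : ∀ j → side M (h 0F j) ≡ side M (h 1F j)
  -- The gap before column zero is the last gap, where the weight condition starts the induction.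
  rows-agree = <-weakInduction (λ j → side M (h 0F j) ≡ side M (h 1F j)) (rows-agree-next zero rows-agree-last)
    (λ i → rows-agree-next (suc i))

  local⇒doubling : M ≡ doubling (lookup (proj₁ M) 0F)
  local⇒doubling = cong₂ _,_ (lookup-injective rows) (lookup-injective λ r → lookup-injective λ j →
      trans (rungs r j) (sym (side-doubling-v S r j)))
    where
    S = lookup (proj₁ M) 0F
    rows : lookup (proj₁ M) ≗ lookup (S ∷ S ∷ [])
    rows 0F = refl
    rows 1F = lookup-injective λ j → sym (rows-agree j)

    rungs : ∀ r j → side M (v r j) ≡ rungSide S r j
    rungs r j with black? (r , j)
    ... | no  white = trans (white-outside loc r j white) (sym (rungSide-white S r j white))
    -- Whichever row is black, the rung of column `j` is also the rung of the bottom node, so its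
    -- side can be read off `S` there.
    ... | yes black = trans (cong (λ r → side M (v r j)) (sym (black⇒blackRow r j black)))
      (trans (exactlyOne⇒nor (local (0F , j))) (sym (rungSide-black S r j black)))

doubling-wWeight : ∀ {m} → ¬ 2 ∣ m → (S : Subset (suc m)) → wWeight (doubling S) ≡ 0ℤ
doubling-wWeight {m} 2∤m S = trans (wWeight≡lastGap 2∤m (doubling S)) (ℤ.+-inverseʳ (indicator (lookup S (fromℕ m))))

-- The bijection and the closed formulas

count-bijection : {A B : Set} {P : A → Set} {Q : B → Set} (P? : Decidable P) (Q? : Decidable Q)
  {xs : List A} {ys : List B} → Unique xs → Unique ys →
  (∀ x → x ∈ˡ xs) → (∀ y → y ∈ˡ ys) →
  (f : B → A) → (∀ {y z} → f y ≡ f z → y ≡ z) →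
  (∀ y → Q y → P (f y)) → (∀ x → P x → ∃ λ y → Q y × x ≡ f y) →
  count P? xs ≡ count Q? ys
count-bijection P? Q? {xs} {ys} xs! ys! ∈xs ∈ys f f-injective Q⇒P P⇒Q = trans
  -- Duplicate-free lists with the same members are permutations of each other, hence equally long;
  -- injectivity of `f` keeps the image list duplicate-free.
  (↭-length (∼bag⇒↭ (unique∧set⇒bag
    (Unique.filter⁺ P? xs!) (Unique.map⁺ f-injective (Unique.filter⁺ Q? ys!)) (mk⇔ to from))))
  (length-map f (filter Q? ys))
  where
  to : ∀ {x} → x ∈ˡ filter P? xs → x ∈ˡ map f (filter Q? ys)
  to {x} x∈ with y , q , refl ← P⇒Q x (proj₂ (∈-filter⁻ P? {xs = xs} x∈)) =
    ∈-map⁺ f (∈-filter⁺ Q? (∈ys y) q)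

  from : ∀ {x} → x ∈ˡ map f (filter Q? ys) → x ∈ˡ filter P? xs
  from x∈ with y , y∈ , refl ← ∈-map⁻ f x∈ =
    ∈-filter⁺ P? (∈xs (f y)) (Q⇒P y (proj₂ (∈-filter⁻ Q? {xs = ys} y∈)))

doubling-injective : ∀ {n} {S T : Subset n} → doubling S ≡ doubling T → S ≡ T
doubling-injective = cong (λ M → lookup (proj₁ M) 0F)

matchings-independents : ∀ {n} p → 2 ≤ n → 2 ∣ n → a n p ≡ numberOfSize (independent? {n}) p
-- With `n` equal to `suc k * 2`, the index of the last column reduces to `suc (k * 2)`, which is
-- odd.
matchings-independents {n} p 2≤n (divides (suc k) refl) = count-bijection (counted? n p) _
  (edgeSets-unique n) (vecs-unique sides-unique n) ∈-edgeSets (∈-vecs ∈-sides)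
  doubling doubling-injective to from
  where
  2∤n-1 : ¬ 2 ∣ suc (k * 2)
  2∤n-1 = even-suc (n∣m*n k)

  to : ∀ (S : Subset n) → Independent S × ∣ S ∣ ≡ p → Counted n p (doubling S)
  to S (ind , refl) = local⇒perfect loc , z , doubling-wWeight 2∤n-1 S
    where
    loc = doubling-local S (independent⇒neighbours S ind)
    z = trans (zWeight-local (suc k) (doubling S) loc) (cong (λ q → + q ℤ.- + ∣ S ∣) (sym (m*n/n≡m (suc k) 2)))

  from : ∀ M → Counted n p M → ∃ λ S → (Independent S × ∣ S ∣ ≡ p) × M ≡ doubling S
  from M (pm , z , w) = S , (neighbours⇒independent S (λ j → exactlyOne⇒notBoth (Local.local loc (0F , j))) , size) ,
    local⇒doubling 2∤n-1 loc w
    where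
    S = lookup (proj₁ M) 0F
    loc = perfect⇒local 2≤n pm
    size : ∣ S ∣ ≡ p
    -- Both `suc k` minus the size of `S` and `suc k` minus `p` equal the `z`-weight, since `n / 2`
    -- is `suc k`.
    size = ℤ.+-injective (ℤ.neg-injective (ℤ-+-cancelˡ (+ suc k) _ _
      (trans (sym (zWeight-local (suc k) M loc)) (trans z (cong (λ q → + q ℤ.- + p) (m*n/n≡m (suc k) 2))))))

mainTheorem1 : ∀ (n p : ℕ) (2≤n : 2 ≤ n) → 2 ∣ n → (p≤n/2 : p ≤ n / 2) →
    (fromℕℚ (a n p) ≡
    ℚ._/_ (+ n) (n ∸ p) {{n∸p≢0 2≤n p≤n/2}} ℚ.* fromℕℚ ((n ∸ p) C p))
    ×
    (1 ≤ p →
    fromℕℚ (a n p) ≡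
    ℚ._/_ (+ n) (p !) {{p !≢0}} ℚ.* fromℕℚ (fallingProduct n p))
mainTheorem1 n@(suc _) p 2≤n 2∣n p≤n/2 =
  -- Both formulas follow from identities for `cyclicCount` with the denominators `n ∸ p` and `p !`
  -- cleared.
  fromℕℚ-quotient (a n p) n (n ∸ p) ((n ∸ p) C p) {{n∸p≢0 2≤n p≤n/2}}
    (trans (cong ((n ∸ p) *_) a≡) ([n∸p]*cyclicCount p<n)) ,
  λ 1≤p → fromℕℚ-quotient (a n p) n (p !) (fallingProduct n p) {{p !≢0}}
    (trans (cong (p ! *_) a≡) (p!*cyclicCount 1≤p p<n))
  where
  p<n : p < n
  p<n = ≤-<-trans p≤n/2 (m/n<m n 2 ≤-refl)

  a≡ : a n p ≡ cyclicCount n p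
  a≡ = trans (matchings-independents p 2≤n 2∣n) (independents-cyclicCount n p 2≤n)
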